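{- Let $c,d\in\mathbb{N}$ and $I=\mathbb{N}^d\times[c]$. Then every $\mathrm{Sym}$-invariant lattice $L\subseteq\mathbb{Z}^{(I)}$ has a finite equivariant generating set, i.e. there is a finite set $\mathcal{B}\subseteq L$ such that $L$ is generated as an abelian group by $\mathrm{Sym}(\mathcal{B})=\{\sigma(\mathbf{u})\mid\sigma\in\mathrm{Sym},\mathbf{u}\in\mathcal{B}\}$.
   Context: $\mathbb{N}=\{1,2,\dots\}$, $[c]=\{1,\dots,c\}$. $\mathbb{Z}^{(I)}$ is the free abelian group with basis $I$ (finitely supported integer vectors indexed by $I$), with standard basis $\mathbf{e}_{\mathbf{i},j}$, $\mathbf{i}\in\mathbb{N}^d$, $j\in[c]$; a lattice is any subgroup of $\mathbb{Z}^{(I)}$. $\mathrm{Sym}$ is the group of permutations of $\mathbb{N}$ fixing all but finitely many elements; it acts on $\mathbb{Z}^{(I)}$ by the linear extension of $\sigma(\mathbf{e}_{(i_1,\dots,i_d),j})=\mathbf{e}_{(\sigma(i_1),\dots,\sigma(i_d)),j}$. A lattice $L$ is $\mathrm{Sym}$-invariant if $\sigma(L)\subseteq L$ for all $\sigma\in\mathrm{Sym}$. -}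

module Defs where

open import Level using (Level; _⊔_; 0ℓ)
open import Algebra.Bundles using (AbelianGroup)
open import Data.Bool using (if_then_else_)
open import Data.Empty using (⊥-elim)
open import Data.Fin using (Fin)
import Data.Fin.Properties as Fin
open import Data.Integer using (ℤ; 0ℤ; 1ℤ; _+_; -_)
import Data.Integer.Properties as ℤ
open import Data.List using (List; []; _∷_; _++_; map)
open import Data.List.Membership.Propositional using (_∈_; _∉_)
open import Data.List.Membership.Propositional.Properties using (∈-++⁺ˡ; ∈-++⁺ʳ; ∈-map⁺)
open import Data.List.Relation.Unary.All using (All)
open import Data.List.Relation.Unary.Any using (here)
open import Data.Nat using (ℕ)
import Data.Nat.Properties as ℕ
open import Data.Product using (∃-syntax; _×_; _,_)
import Data.Product.Properties as Product
open import Data.Vec using (Vec)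
import Data.Vec as Vec
import Data.Vec.Properties as Vec
open import Function using (_∘_)
open import Function.Bundles using (_↔_; Inverse)
open import Relation.Binary.Definitions using (DecidableEquality)
open import Relation.Binary.PropositionalEquality using (_≡_; refl; sym; trans; cong; cong₂; subst)
open import Relation.Nullary using (does; yes; no)
open import Relation.Unary using (Pred; _≐_)

-- Subsets of a setoid are predicates, so a subgroup must also respect _≈_.

module _ {a ℓ₁ : Level} (G : AbelianGroup a ℓ₁) where
  open AbelianGroup G

  record IsSubgroup {ℓ : Level} (L : Pred Carrier ℓ) : Set (a ⊔ ℓ₁ ⊔ ℓ) where
    field
      resp      : ∀ {u v} → u ≈ v → L u → L v
      ε-closed  : L ε
      ∙-closed  : ∀ {u v} → L u → L v → L (u ∙ v)
      ⁻¹-closed : ∀ {u} → L u → L (u ⁻¹)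

  data Generated {ℓ : Level} (S : Pred Carrier ℓ) : Pred Carrier (a ⊔ ℓ₁ ⊔ ℓ) where
    gen  : ∀ {u} → S u → Generated S u
    resp : ∀ {u v} → u ≈ v → Generated S u → Generated S v
    unit : Generated S ε
    mult : ∀ {u v} → Generated S u → Generated S v → Generated S (u ∙ v)
    inv  : ∀ {u} → Generated S u → Generated S (u ⁻¹)

-- Here and in Index the countable label set {1,2,…} is represented by
-- ℕ = {0,1,…}, and [c] = {1,…,c} by Fin c.

record FinPerm : Set where
  field
    perm  : ℕ ↔ ℕ
    moved : List ℕ
    fixes : ∀ n → n ∉ moved → Inverse.to perm n ≡ n

  open Inverse perm public using (to; from; strictlyInverseˡ; strictlyInverseʳ)

Index : (c d : ℕ) → Set
Index c d = Vec ℕ d × Fin c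

module _ {c d : ℕ} where

  _≟ᴵ_ : DecidableEquality (Index c d)
  _≟ᴵ_ = Product.≡-dec (Vec.≡-dec ℕ._≟_) Fin._≟_

  actᴵ actᴵ⁻¹ : FinPerm → Index c d → Index c d
  actᴵ   σ (i , j) = Vec.map (FinPerm.to σ) i , j
  actᴵ⁻¹ σ (i , j) = Vec.map (FinPerm.from σ) i , j

  private
    map-cancel : ∀ {n} (f g : ℕ → ℕ) → (∀ x → f (g x) ≡ x) →
                 (i : Vec ℕ n) → Vec.map f (Vec.map g i) ≡ i
    map-cancel f g h i =
      trans (sym (Vec.map-∘ f g i)) (trans (Vec.map-cong h i) (Vec.map-id i))

  actᴵ-actᴵ⁻¹ : ∀ σ k → actᴵ σ (actᴵ⁻¹ σ k) ≡ k
  actᴵ-actᴵ⁻¹ σ (i , j) = cong (_, j) (map-cancel (FinPerm.to σ) (FinPerm.from σ) (FinPerm.strictlyInverseˡ σ) i)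

  actᴵ⁻¹-actᴵ : ∀ σ k → actᴵ⁻¹ σ (actᴵ σ k) ≡ k
  actᴵ⁻¹-actᴵ σ (i , j) = cong (_, j) (map-cancel (FinPerm.from σ) (FinPerm.to σ) (FinPerm.strictlyInverseʳ σ) i)

-- The list `supp` may contain
-- repetitions and indices with zero coefficient; it is ignored by _≈_.

record FinSupp (c d : ℕ) : Set where
  field
    coeff  : Index c d → ℤ
    supp   : List (Index c d)
    vanish : ∀ k → k ∉ supp → coeff k ≡ 0ℤ

open FinSupp public

module _ {c d : ℕ} where

  infix  4 _≈_
  infixl 6 _⊕_
  infix  8 ⊖_
  infixr 9 _·_

  _≈_ : FinSupp c d → FinSupp c d → Set
  u ≈ v = ∀ k → coeff u k ≡ coeff v k

  𝟎 : FinSupp c d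
  𝟎 = record { coeff = λ _ → 0ℤ ; supp = [] ; vanish = λ _ _ → refl }

  _⊕_ : FinSupp c d → FinSupp c d → FinSupp c d
  u ⊕ v = record
    { coeff  = λ k → coeff u k + coeff v k
    ; supp   = supp u ++ supp v
    ; vanish = λ k k∉ → cong₂ _+_ (vanish u k (k∉ ∘ ∈-++⁺ˡ))
                                  (vanish v k (k∉ ∘ ∈-++⁺ʳ (supp u)))
    }

  ⊖_ : FinSupp c d → FinSupp c d
  ⊖ u = record
    { coeff  = λ k → - coeff u k
    ; supp   = supp u
    ; vanish = λ k k∉ → cong -_ (vanish u k k∉)
    }

  𝐞 : Index c d → FinSupp c d
  𝐞 i = record
    { coeff  = λ k → if does (k ≟ᴵ i) then 1ℤ else 0ℤ
    ; supp   = i ∷ []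
    ; vanish = van
    }
    where
    van : ∀ k → k ∉ i ∷ [] → (if does (k ≟ᴵ i) then 1ℤ else 0ℤ) ≡ 0ℤ
    van k k∉ with k ≟ᴵ i
    ... | yes k≡i = ⊥-elim (k∉ (here k≡i))
    ... | no  _   = refl

  -- In coordinates, the linear extension of 𝐞 k ↦ 𝐞 (actᴵ σ k) sends u to
  -- the vector whose k-th coefficient is the (σ⁻¹ k)-th coefficient of u;
  -- see ·-𝐞, ·-⊕ and ·-⊖ below.
  _·_ : FinPerm → FinSupp c d → FinSupp c d
  σ · u = record
    { coeff  = λ k → coeff u (actᴵ⁻¹ σ k)
    ; supp   = map (actᴵ σ) (supp u)
    ; vanish = λ k k∉ → vanish u (actᴵ⁻¹ σ k)
        (λ p → k∉ (subst (_∈ map (actᴵ σ) (supp u)) (actᴵ-actᴵ⁻¹ σ k) (∈-map⁺ (actᴵ σ) p)))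
    }

  ·-𝐞 : ∀ σ i → σ · 𝐞 i ≈ 𝐞 (actᴵ σ i)
  ·-𝐞 σ i k with actᴵ⁻¹ σ k ≟ᴵ i | k ≟ᴵ actᴵ σ i
  ... | yes _ | yes _ = refl
  ... | no  _ | no  _ = refl
  ... | yes p | no ¬q = ⊥-elim (¬q (trans (sym (actᴵ-actᴵ⁻¹ σ k)) (cong (actᴵ σ) p)))
  ... | no ¬p | yes q = ⊥-elim (¬p (trans (cong (actᴵ⁻¹ σ) q) (actᴵ⁻¹-actᴵ σ i)))

  ·-cong : ∀ σ {u v} → u ≈ v → σ · u ≈ σ · v
  ·-cong σ u≈v k = u≈v (actᴵ⁻¹ σ k)

  ·-⊕ : ∀ σ u v → σ · (u ⊕ v) ≈ σ · u ⊕ σ · v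
  ·-⊕ σ u v k = refl

  ·-⊖ : ∀ σ u → σ · (⊖ u) ≈ ⊖ (σ · u)
  ·-⊖ σ u k = refl

ℤ^⟨_,_⟩ : (c d : ℕ) → AbelianGroup 0ℓ 0ℓ
ℤ^⟨ c , d ⟩ = record
  { Carrier = FinSupp c d
  ; _≈_     = _≈_
  ; _∙_     = _⊕_
  ; ε       = 𝟎
  ; _⁻¹     = ⊖_
  ; isAbelianGroup = record
    { isGroup = record
      { isMonoid = record
        { isSemigroup = record
          { isMagma = record
            { isEquivalence = record
              { refl  = λ _ → refl
              ; sym   = λ p k → sym (p k)
              ; trans = λ p q k → trans (p k) (q k)
              }
            ; ∙-cong = λ p q k → cong₂ _+_ (p k) (q k)
            }
          ; assoc = λ u v w k → ℤ.+-assoc (coeff u k) (coeff v k) (coeff w k)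
          }
        ; identity = (λ u k → ℤ.+-identityˡ (coeff u k)) , (λ u k → ℤ.+-identityʳ (coeff u k))
        }
      ; inverse = (λ u k → ℤ.+-inverseˡ (coeff u k)) , (λ u k → ℤ.+-inverseʳ (coeff u k))
      ; ⁻¹-cong = λ p k → cong -_ (p k)
      }
    ; comm = λ u v k → ℤ.+-comm (coeff u k) (coeff v k)
    }
  }

module _ {c d : ℕ} where

  IsLattice : {ℓ : Level} → Pred (FinSupp c d) ℓ → Set ℓ
  IsLattice = IsSubgroup ℤ^⟨ c , d ⟩

  SymInvariant : {ℓ : Level} → Pred (FinSupp c d) ℓ → Set ℓ
  SymInvariant L = ∀ (σ : FinPerm) {u} → L u → L (σ · u)

  SymOrbit : List (FinSupp c d) → Pred (FinSupp c d) 0ℓ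
  SymOrbit B v = ∃[ σ ] ∃[ u ] (u ∈ B × v ≈ σ · u)

  HasFiniteEquivariantGeneratingSet : {ℓ : Level} → Pred (FinSupp c d) ℓ → Set ℓ
  HasFiniteEquivariantGeneratingSet L =
    ∃[ B ] (All L B × L ≐ Generated ℤ^⟨ c , d ⟩ (SymOrbit B))

{-# OPTIONS --safe #-}

-- Order ℕ^d × [c] lexicographically: strictly increasing maps ℕ → ℕ preserve
-- this well-order.  If L is not finitely generated, repeatedly pick in L an
-- element outside the span of the orbits of the previous ones whose leading
-- index k and then whose |leading coefficient| are minimal.  By Dickson's lemma
-- two of them, u before v, have leading data (k , a) and (k′ , a′) such that
-- k′ = f k for a strictly increasing f, and |a| ≤ |a′|.  On the entries
-- occurring in u, f agrees with a finite permutation σ, and v ± σ u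
-- contradicts the minimality of v.

module Submission where

open import Defs
open import Level using (Level; 0ℓ; Lift; lift; lower)
open import Data.Nat using (ℕ; NonZero)
open import Relation.Unary using (Pred)
open import Axiom.ExcludedMiddle using (ExcludedMiddle)

open import Data.Nat using (zero; suc; _+_; _∸_; _⊔_; _≤_; _<_; z≤n; s≤s; s≤s⁻¹)
import Data.Nat.Properties as ℕ
import Data.Nat.Induction as ℕ
open import Data.Empty using (⊥; ⊥-elim)
open import Data.Integer using (ℤ; 0ℤ; -[1+_]; ∣_∣)
import Data.Integer as ℤ
import Data.Integer.Properties as ℤ
open import Data.Fin using (Fin; zero; suc; toℕ)
import Data.Fin.Properties as Fin
import Data.Fin.Induction as Fin
open import Data.List using (List; []; _∷_; _++_; map; tabulate; allFin; cartesianProductWith; concatMap)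
open import Data.List.Membership.Propositional using (_∈_; lose)
open import Data.List.Membership.Propositional.Properties
  using (∈-map⁺; ∈-++⁺ˡ; ∈-++⁺ʳ; ∈-tabulate⁺; ∈-allFin; ∈-cartesianProductWith⁺; ∈-concatMap⁺)
import Data.List.Membership.DecPropositional as DecMembership
open import Data.List.Relation.Unary.All as All using (All; []; _∷_)
open import Data.List.Relation.Unary.Any using (here; there)
open import Data.Product using (∃; ∃-syntax; _×_; _,_; proj₁; proj₂)
open import Data.Product.Relation.Binary.Lex.Strict using (×-Lex; ×-strictTotalOrder; ×-wellFounded; ×-wellFounded')
open import Data.Sum using (_⊎_; inj₁; inj₂)
open import Data.Vec as Vec using (Vec; []; _∷_; lookup; toList)
import Data.Vec.Properties as Vec
open import Data.Vec.Relation.Binary.Lex.Strict as Lex using (Lex-<; this; next)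
open import Data.Vec.Relation.Binary.Pointwise.Inductive as Pointwise using (Pointwise-≡⇒≡; ≡⇒Pointwise-≡)
open import Function using (_∘_; id)
open import Function.Bundles using (mk↔ₛ′)
open import Induction.WellFounded using (WellFounded; Acc; acc)
open import Relation.Binary.Bundles using (StrictTotalOrder)
open import Relation.Binary.Core using (Rel; _Preserves_⟶_)
open import Relation.Binary.Definitions using (tri<; tri≈; tri>)
open import Relation.Binary.PropositionalEquality using (_≡_; _≢_; refl; sym; trans; cong; cong₂; subst; respʳ; module ≡-Reasoning)
open import Relation.Nullary using (¬_; Dec; yes; no; contradiction)
open import Relation.Nullary.Decidable as Dec using (decidable-stable)

-- Dickson's lemma

-- Descend from the given witness as long as a smaller one exists; accessibility makes the descent
-- stop. `smaller?` is the only decision needed.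
least : ∀ {a r ℓ} {A : Set a} {_≺_ : Rel A r} → WellFounded _≺_ →
        (P : Pred A ℓ) → (∀ x → Dec (∃[ y ] (y ≺ x × P y))) →
        ∃ P → ∃[ x ] (P x × ∀ y → y ≺ x → ¬ P y)
least {_≺_ = _≺_} wf P smaller? (x₀ , px₀) = go (wf x₀) px₀
  where
  go : ∀ {x} → Acc _≺_ x → P x → ∃[ x ] (P x × ∀ y → y ≺ x → ¬ P y)
  go {x} (acc rec) px with smaller? x
  ... | yes (y , y≺x , py) = go (rec y≺x) py
  ... | no  none           = x , px , λ y y≺x py → none (y , y≺x , py)

NondecreasingAlong : (ℕ → ℕ) → Pred (ℕ → ℕ) 0ℓ
NondecreasingAlong φ f = ∀ m n → m < n → f (φ m) ≤ f (φ n)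

module _ (em : ExcludedMiddle 0ℓ) where

  tailMinimum : (f : ℕ → ℕ) (m : ℕ) → ∃[ n ] (m ≤ n × ∀ k → m ≤ k → f n ≤ f k)
  tailMinimum f m
    with least ℕ.<-wellFounded (λ v → ∃[ n ] (m ≤ n × f n ≡ v)) (λ _ → em) (f m , m , ℕ.≤-refl , refl)
  ... | _ , (n , m≤n , refl) , minimal =
    n , m≤n , λ k m≤k → ℕ.≮⇒≥ λ fk<fn → minimal (f k) fk<fn (k , m≤k , refl)

  -- Each index is a position where `f` attains its minimum over all indices beyond the previous
  -- one, so no later value can be smaller.
  nondecreasingSubsequence : (f : ℕ → ℕ) →
    ∃[ φ ] (φ Preserves _<_ ⟶ _<_ × NondecreasingAlong φ f)
  nondecreasingSubsequence f = φ , φ-mono , λ m n m<n → φ-min m (φ n) (ℕ.<⇒≤ (φ-mono m<n))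
    where
    tailMin = tailMinimum f

    φ : ℕ → ℕ
    φ zero    = proj₁ (tailMin 0)
    φ (suc n) = proj₁ (tailMin (suc (φ n)))

    φ-min : ∀ n k → φ n ≤ k → f (φ n) ≤ f k
    φ-min zero    k φ≤k = proj₂ (proj₂ (tailMin 0)) k z≤n
    φ-min (suc n) k φ≤k with tailMin (suc (φ n))
    ... | _ , ≤φ , min = min k (ℕ.≤-trans ≤φ φ≤k)

    φ-step : ∀ n → φ n < φ (suc n)
    φ-step n = proj₁ (proj₂ (tailMin (suc (φ n))))

    φ-mono : φ Preserves _<_ ⟶ _<_
    φ-mono {m} {suc n} m<1+n with ℕ.m<1+n⇒m<n∨m≡n m<1+n
    ... | inj₁ m<n  = ℕ.<-trans (φ-mono m<n) (φ-step n)
    ... | inj₂ refl = φ-step n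

  -- The subsequence is refined for one function at a time: being nondecreasing survives passing to
  -- a further subsequence.
  dickson : (fs : List (ℕ → ℕ)) →
    ∃[ φ ] (φ Preserves _<_ ⟶ _<_ × All (NondecreasingAlong φ) fs)
  dickson []       = id , id , []
  dickson (f ∷ fs) with dickson fs
  ... | φ , φ-mono , fs-mono with nondecreasingSubsequence (f ∘ φ)
  ...   | ψ , ψ-mono , f-mono =
    φ ∘ ψ , φ-mono ∘ ψ-mono , f-mono ∷ All.map (λ mono _ _ → mono _ _ ∘ ψ-mono) fs-mono

  abstract
    dickson-pair : ∀ {a} {A : Set a} (fs : List (A → ℕ)) (x : ℕ → A) →
      ∃[ m ] ∃[ n ] (m < n × ∀ f → f ∈ fs → f (x m) ≤ f (x n))
    dickson-pair fs x with dickson (map (_∘ x) fs)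
    ... | φ , φ-mono , mono =
      φ 0 , φ 1 , φ-mono (s≤s z≤n) , λ f f∈fs → All.lookup mono (∈-map⁺ (_∘ x) f∈fs) 0 1 (s≤s z≤n)

-- Strictly increasing maps between tuples

private variable
  c d n : ℕ

-- Using suc, one inequality covers both i_p < i_q (the gap may only grow)
-- and i_p ≡ i_q (equal entries stay equal).
_⊑_ : Rel (Vec ℕ n) 0ℓ
i ⊑ i′ = (∀ p → lookup i p ≤ lookup i′ p) ×
         (∀ p q → suc (lookup i q) ∸ lookup i p ≤ suc (lookup i′ q) ∸ lookup i′ p)

-- If the gap from `a` to `b` does not shrink, then `b` moves at least as far as `a`. Because
-- `suc b ∸ a` is positive, so is `suc b′ ∸ a′`, and neither subtraction is truncated.
shift-mono : ∀ {a b a′ b′} → a ≤ b → a ≤ a′ → suc b ∸ a ≤ suc b′ ∸ a′ → a′ ∸ a ≤ b′ ∸ b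
shift-mono {a} {b} {a′} {b′} a≤b a≤a′ gap = ℕ.m+n≤o⇒m≤o∸n (a′ ∸ a) (begin
  (a′ ∸ a) + b              ≡⟨ cong ((a′ ∸ a) +_) (ℕ.m+[n∸m]≡n a≤b) ⟨
  (a′ ∸ a) + (a + (b ∸ a))  ≡⟨ ℕ.+-assoc (a′ ∸ a) a (b ∸ a) ⟨
  (a′ ∸ a) + a + (b ∸ a)    ≡⟨ cong (_+ (b ∸ a)) (ℕ.m∸n+n≡m a≤a′) ⟩
  a′ + (b ∸ a)              ≡⟨ ℕ.+-comm a′ (b ∸ a) ⟩
  (b ∸ a) + a′              ≤⟨ s≤s⁻¹ (ℕ.m≤o∸n⇒m+n≤o (suc (b ∸ a)) a′≤1+b′ gap′) ⟩
  b′                        ∎)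
  where
  open ℕ.≤-Reasoning
  gap′ : suc (b ∸ a) ≤ suc b′ ∸ a′
  gap′ = subst (_≤ suc b′ ∸ a′) (ℕ.+-∸-assoc 1 a≤b) gap
  a′≤1+b′ : a′ ≤ suc b′
  a′≤1+b′ = ℕ.<⇒≤ (ℕ.m∸n≢0⇒n<m (ℕ.>⇒≢ (ℕ.≤-trans (s≤s z≤n) gap′)))

-- The displacement at `x` of a map extending the assignment of the entries of `i` to those of `i′`.
-- Taking the maximum over all entries up to `x` makes it nondecreasing in `x`.
shift : Vec ℕ n → Vec ℕ n → ℕ → ℕ
shift []      []        x = 0
shift (a ∷ i) (a′ ∷ i′) x with a ℕ.≤? x
... | yes _ = (a′ ∸ a) ⊔ shift i i′ x
... | no  _ = shift i i′ x

shift-lub : ∀ (i i′ : Vec ℕ n) x {m} →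
            (∀ p → lookup i p ≤ x → lookup i′ p ∸ lookup i p ≤ m) → shift i i′ x ≤ m
shift-lub []      []        x bound = z≤n
shift-lub (a ∷ i) (a′ ∷ i′) x bound with a ℕ.≤? x
... | yes a≤x = ℕ.⊔-lub (bound zero a≤x) (shift-lub i i′ x (bound ∘ suc))
... | no  _   = shift-lub i i′ x (bound ∘ suc)

shift-ub : ∀ (i i′ : Vec ℕ n) {x} p → lookup i p ≤ x → lookup i′ p ∸ lookup i p ≤ shift i i′ x
shift-ub (a ∷ i) (a′ ∷ i′) {x} p ≤x with a ℕ.≤? x
shift-ub (a ∷ i) (a′ ∷ i′) {x} zero    ≤x | yes _   = ℕ.m≤m⊔n _ _
shift-ub (a ∷ i) (a′ ∷ i′) {x} zero    ≤x | no  a≰x = contradiction ≤x a≰x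
shift-ub (a ∷ i) (a′ ∷ i′) {x} (suc p) ≤x | yes _   = ℕ.m≤n⇒m≤o⊔n (a′ ∸ a) (shift-ub i i′ p ≤x)
shift-ub (a ∷ i) (a′ ∷ i′) {x} (suc p) ≤x | no  _   = shift-ub i i′ p ≤x

lookup-injective : ∀ {v w : Vec ℕ n} → (∀ p → lookup v p ≡ lookup w p) → v ≡ w
lookup-injective {v = v} {w} eq =
  trans (sym (Vec.tabulate∘lookup v)) (trans (Vec.tabulate-cong eq) (Vec.tabulate∘lookup w))

-- The identity plus a nondecreasing displacement is strictly increasing. At an entry of `i` the
-- maximum in `shift` is that entry's own displacement, since by `shift-mono` smaller entries move
-- no further.
⊑⇒increasing : ∀ (i i′ : Vec ℕ n) → i ⊑ i′ → ∃[ f ] (f Preserves _<_ ⟶ _<_ × Vec.map f i ≡ i′)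
⊑⇒increasing i i′ (entries , gaps) = f , f-mono , lookup-injective f-lookup
  where
  f : ℕ → ℕ
  f x = x + shift i i′ x

  f-mono : f Preserves _<_ ⟶ _<_
  f-mono {x} {y} x<y = ℕ.+-mono-<-≤ x<y
    (shift-lub i i′ x λ p ≤x → shift-ub i i′ p (ℕ.≤-trans ≤x (ℕ.<⇒≤ x<y)))

  f-lookup : ∀ q → lookup (Vec.map f i) q ≡ lookup i′ q
  f-lookup q = begin
    lookup (Vec.map f i) q               ≡⟨ Vec.lookup-map q f i ⟩
    iq + shift i i′ iq                   ≡⟨ cong (iq +_) (ℕ.≤-antisym
                                              (shift-lub i i′ iq λ p p≤q → shift-mono p≤q (entries p) (gaps p q))
                                              (shift-ub i i′ q ℕ.≤-refl)) ⟩
    iq + (lookup i′ q ∸ iq)              ≡⟨ ℕ.m+[n∸m]≡n (entries q) ⟩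
    lookup i′ q                          ∎
    where
    open ≡-Reasoning
    iq = lookup i q

-- Finite permutations

swap : ℕ → ℕ → ℕ → ℕ
swap a b x with x ℕ.≟ a | x ℕ.≟ b
... | yes _ | _     = b
... | no  _ | yes _ = a
... | no  _ | no  _ = x

swap-left : ∀ a b → swap a b a ≡ b
swap-left a b with a ℕ.≟ a
... | yes _   = refl
... | no  a≢a = contradiction refl a≢a

swap-right : ∀ a b → swap a b b ≡ a
swap-right a b with b ℕ.≟ a | b ℕ.≟ b
... | yes b≡a | _       = b≡a
... | no  _   | yes _   = refl
... | no  _   | no  b≢b = contradiction refl b≢b

swap-other : ∀ {a b x} → x ≢ a → x ≢ b → swap a b x ≡ x
swap-other {a} {b} {x} x≢a x≢b with x ℕ.≟ a | x ℕ.≟ b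
... | yes x≡a | _       = contradiction x≡a x≢a
... | no  _   | yes x≡b = contradiction x≡b x≢b
... | no  _   | no  _   = refl

swap-involutive : ∀ a b x → swap a b (swap a b x) ≡ x
swap-involutive a b x with x ℕ.≟ a | x ℕ.≟ b
... | yes refl | _        = swap-right a b
... | no  _    | yes refl = swap-left a b
... | no  x≢a  | no  x≢b  = swap-other x≢a x≢b

identity : FinPerm
identity = record { perm = mk↔ₛ′ id id (λ _ → refl) (λ _ → refl) ; moved = [] ; fixes = λ _ _ → refl }

swap-after : ℕ → ℕ → FinPerm → FinPerm
swap-after a b σ = record
  { perm  = mk↔ₛ′ (swap a b ∘ to) (from ∘ swap a b)
      (λ x → trans (cong (swap a b) (strictlyInverseˡ (swap a b x))) (swap-involutive a b x))
      (λ x → trans (cong from (swap-involutive a b (to x))) (strictlyInverseʳ x))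
  ; moved = a ∷ b ∷ moved
  ; fixes = λ n n∉ → trans (cong (swap a b) (fixes n (n∉ ∘ there ∘ there)))
                           (swap-other (n∉ ∘ here) (n∉ ∘ there ∘ here))
  }
  where open FinPerm σ

FinPerm-injective : ∀ σ {x y} → FinPerm.to σ x ≡ FinPerm.to σ y → x ≡ y
FinPerm-injective σ {x} {y} eq = trans (sym (strictlyInverseʳ x)) (trans (cong from eq) (strictlyInverseʳ y))
  where open FinPerm σ

-- Correct the permutation found for `xs` by the transposition of its value at `x` with `f x`.
-- Injectivity of both maps keeps this transposition away from the values at the other entries.
extendToFinPerm : ∀ {f : ℕ → ℕ} → (∀ {x y} → f x ≡ f y → x ≡ y) → (xs : List ℕ) →
                  ∃[ σ ] (∀ {x} → x ∈ xs → FinPerm.to σ x ≡ f x)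
extendToFinPerm f-inj [] = identity , λ ()
extendToFinPerm {f} f-inj (x ∷ xs) with extendToFinPerm f-inj xs
... | σ , agree = swap-after (to x) (f x) σ , agree′
  where
  open FinPerm σ
  agree′ : ∀ {y} → y ∈ x ∷ xs → swap (to x) (f x) (to y) ≡ f y
  agree′ (here refl) = swap-left (to x) (f x)
  agree′ {y} (there y∈xs) with y ℕ.≟ x
  -- The list may repeat `x`.
  ... | yes refl = swap-left (to x) (f x)
  ... | no  y≢x  = trans (swap-other (y≢x ∘ FinPerm-injective σ)
                                     (λ eq → y≢x (f-inj (trans (sym (agree y∈xs)) eq))))
                         (agree y∈xs)

increasing⇒injective : ∀ {f : ℕ → ℕ} → f Preserves _<_ ⟶ _<_ → ∀ {x y} → f x ≡ f y → x ≡ y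
increasing⇒injective f-mono {x} {y} eq with ℕ.<-cmp x y
... | tri< x<y _ _ = contradiction eq (ℕ.<⇒≢ (f-mono x<y))
... | tri≈ _ x≡y _ = x≡y
... | tri> _ _ y<x = contradiction (sym eq) (ℕ.<⇒≢ (f-mono y<x))

map-cong-∈ : ∀ {f g : ℕ → ℕ} (v : Vec ℕ n) → (∀ {x} → x ∈ toList v → f x ≡ g x) → Vec.map f v ≡ Vec.map g v
map-cong-∈ []      eq = refl
map-cong-∈ (x ∷ v) eq = cong₂ _∷_ (eq (here refl)) (map-cong-∈ v (eq ∘ there))

mapᴵ : (ℕ → ℕ) → Index c d → Index c d
mapᴵ f (i , j) = Vec.map f i , j

realise : ∀ {f : ℕ → ℕ} → f Preserves _<_ ⟶ _<_ → (ks : List (Index c d)) →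
          ∃[ σ ] (∀ {k} → k ∈ ks → actᴵ σ k ≡ mapᴵ f k)
realise {f = f} f-mono ks with extendToFinPerm (increasing⇒injective f-mono) (concatMap (toList ∘ proj₁) ks)
... | σ , agree = σ , λ {k} k∈ks →
  cong (_, proj₂ k) (map-cong-∈ (proj₁ k) λ x∈k → agree (∈-concatMap⁺ (toList ∘ proj₁) (lose k∈ks x∈k)))

-- The lexicographic order and leading terms

module _ {c d : ℕ} where

  Index-order : StrictTotalOrder 0ℓ 0ℓ 0ℓ
  Index-order = ×-strictTotalOrder (Lex.<-strictTotalOrder ℕ.<-strictTotalOrder d) (Fin.<-strictTotalOrder c)

  private module Ord = StrictTotalOrder Index-order

  infix 4 _<ᴵ_
  _<ᴵ_ : Rel (Index c d) 0ℓ
  _<ᴵ_ = Ord._<_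

  <ᴵ-wellFounded : WellFounded _<ᴵ_
  <ᴵ-wellFounded = ×-wellFounded'
    (Pointwise.trans trans)
    (Lex.<-respectsʳ (StrictTotalOrder.Eq.isPartialEquivalence ℕ.<-strictTotalOrder) (respʳ _<_))
    (Lex.<-wellFounded trans (respʳ _<_) ℕ.<-wellFounded)
    Fin.<-wellFounded

  compareᴵ : ∀ k m → k <ᴵ m ⊎ k ≡ m ⊎ m <ᴵ k
  compareᴵ k m with Ord.compare k m
  ... | tri< k<m _ _       = inj₁ k<m
  ... | tri≈ _ (p , q) _   = inj₂ (inj₁ (cong₂ _,_ (Pointwise-≡⇒≡ p) q))
  ... | tri> _ _ m<k       = inj₂ (inj₂ m<k)

  <ᴵ-irrefl : ∀ {k} → ¬ k <ᴵ k
  <ᴵ-irrefl = Ord.irrefl Ord.Eq.refl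

  module _ {f : ℕ → ℕ} (f-mono : f Preserves _<_ ⟶ _<_) where

    map-mono : ∀ {n} {v w : Vec ℕ n} → Lex-< _≡_ _<_ v w → Lex-< _≡_ _<_ (Vec.map f v) (Vec.map f w)
    map-mono {v = []}    {[]}    (Lex.base ())
    map-mono {v = _ ∷ _} {_ ∷ _} (this x<y eq)  = this (f-mono x<y) eq
    map-mono {v = _ ∷ _} {_ ∷ _} (next x≡y v<w) = next (cong f x≡y) (map-mono v<w)

    mapᴵ-mono : ∀ {k m} → k <ᴵ m → mapᴵ f k <ᴵ mapᴵ f m
    mapᴵ-mono (inj₁ i<i′)         = inj₁ (map-mono i<i′)
    mapᴵ-mono (inj₂ (i≈i′ , j<j′)) =
      inj₂ (≡⇒Pointwise-≡ (cong (Vec.map f) (Pointwise-≡⇒≡ i≈i′)) , j<j′)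

    mapᴵ-cancel-< : ∀ {k m} → mapᴵ f k <ᴵ mapᴵ f m → k <ᴵ m
    mapᴵ-cancel-< {k} {m} fk<fm with compareᴵ k m
    ... | inj₁ k<m         = k<m
    ... | inj₂ (inj₁ refl) = contradiction fk<fm <ᴵ-irrefl
    ... | inj₂ (inj₂ m<k)  = contradiction (mapᴵ-mono m<k) (Ord.asym fk<fm)

  -- Comparison of leading data: an index with an absolute value

  infix 4 _≺_
  _≺_ : Rel (Index c d × ℕ) 0ℓ
  _≺_ = ×-Lex _≡_ _<ᴵ_ _<_

  ≺-wellFounded : WellFounded _≺_
  ≺-wellFounded = ×-wellFounded <ᴵ-wellFounded ℕ.<-wellFounded

  infix 4 _≼_
  _≼_ : Rel (Index c d × ℕ) 0ℓ
  ((i , j) , a) ≼ ((i′ , j′) , a′) = i ⊑ i′ × j ≡ j′ × a ≤ a′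

  private
    entry : Fin d → Index c d × ℕ → ℕ
    entry p ((i , _) , _) = lookup i p

    gap : Fin d → Fin d → Index c d × ℕ → ℕ
    gap p q ((i , _) , _) = suc (lookup i q) ∸ lookup i p

    -- The label and its complement to `c` can both be nondecreasing only if the label is constant,
    -- so two inequalities encode `j ≡ j′`.
    label colabel : Index c d × ℕ → ℕ
    label   ((_ , j) , _) = toℕ j
    colabel ((_ , j) , _) = c ∸ toℕ j

    features : List (Index c d × ℕ → ℕ)
    features = proj₂ ∷ label ∷ colabel ∷ tabulate entry ++ cartesianProductWith gap (allFin d) (allFin d)

    features⇒≼ : ∀ x y → (∀ f → f ∈ features → f x ≤ f y) → x ≼ y
    features⇒≼ ((i , j) , a) ((i′ , j′) , a′) f≤ = (entries , gaps) , labels , f≤ proj₂ (here refl)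
      where
      entries : ∀ p → lookup i p ≤ lookup i′ p
      entries p = f≤ (entry p) (there (there (there (∈-++⁺ˡ (∈-tabulate⁺ p)))))

      gaps : ∀ p q → suc (lookup i q) ∸ lookup i p ≤ suc (lookup i′ q) ∸ lookup i′ p
      gaps p q = f≤ (gap p q) (there (there (there (∈-++⁺ʳ (tabulate entry)
        (∈-cartesianProductWith⁺ gap (∈-allFin p) (∈-allFin q))))))

      labels : j ≡ j′
      labels = Fin.toℕ-injective (ℕ.≤-antisym (f≤ label (there (here refl)))
        (ℕ.∸-cancelʳ-≤ (Fin.toℕ≤n j′) (f≤ colabel (there (there (here refl))))))

  ≼-good : ExcludedMiddle 0ℓ → (x : ℕ → Index c d × ℕ) → ∃[ m ] ∃[ n ] (m < n × x m ≼ x n)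
  ≼-good em x with dickson-pair em features x
  ... | m , n , m<n , f≤ = m , n , m<n , features⇒≼ (x m) (x n) f≤

  VanishesAbove : Index c d → Pred (FinSupp c d) 0ℓ
  VanishesAbove k u = ∀ {m} → k <ᴵ m → coeff u m ≡ 0ℤ

  Leads : Index c d → Pred (FinSupp c d) 0ℓ
  Leads k u = coeff u k ≢ 0ℤ × VanishesAbove k u

  open DecMembership (_≟ᴵ_ {c} {d}) using (_∈?_)

  -- A support list is unordered and may contain repetitions and zero coefficients, so the leading
  -- index has to be searched for.
  lastNonzero : (g : Index c d → ℤ) (ks : List (Index c d)) →
    (∀ {m} → m ∈ ks → g m ≡ 0ℤ) ⊎
    ∃[ k ] (g k ≢ 0ℤ × (∀ {m} → m ∈ ks → k <ᴵ m → g m ≡ 0ℤ))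
  lastNonzero g [] = inj₁ λ ()
  lastNonzero g (x ∷ ks) with g x ℤ.≟ 0ℤ | lastNonzero g ks
  ... | yes gx≡0 | inj₁ zeros = inj₁ λ { (here refl) → gx≡0 ; (there m∈ks) → zeros m∈ks }
  ... | yes gx≡0 | inj₂ (k , gk≢0 , last) =
    inj₂ (k , gk≢0 , λ { (here refl) _ → gx≡0 ; (there m∈ks) → last m∈ks })
  ... | no  gx≢0 | inj₁ zeros =
    inj₂ (x , gx≢0 , λ { (here refl) x<x → contradiction x<x <ᴵ-irrefl ; (there m∈ks) _ → zeros m∈ks })
  ... | no  gx≢0 | inj₂ (k , gk≢0 , last) with compareᴵ k x
  ...   | inj₁ k<x         =
    inj₂ (x , gx≢0 , λ { (here refl) x<x → contradiction x<x <ᴵ-irrefl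
                       ; (there m∈ks) x<m → last m∈ks (Ord.trans k<x x<m) })
  ...   | inj₂ (inj₁ refl) =
    inj₂ (x , gx≢0 , λ { (here refl) x<x → contradiction x<x <ᴵ-irrefl ; (there m∈ks) → last m∈ks })
  ...   | inj₂ (inj₂ x<k)  =
    inj₂ (k , gk≢0 , λ { (here refl) k<x → contradiction k<x (Ord.asym x<k) ; (there m∈ks) → last m∈ks })

  zeroOrLeads : ∀ u → u ≈ 𝟎 ⊎ ∃[ k ] Leads k u
  zeroOrLeads u with lastNonzero (coeff u) (supp u)
  ... | inj₁ zeros = inj₁ u≈𝟎
    where
    u≈𝟎 : u ≈ 𝟎
    u≈𝟎 m with m ∈? supp u
    ... | yes m∈ = zeros m∈
    ... | no  m∉ = vanish u m m∉
  ... | inj₂ (k , nonzero , last) = inj₂ (k , nonzero , above)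
    where
    above : VanishesAbove k u
    above {m} k<m with m ∈? supp u
    ... | yes m∈ = last m∈ k<m
    ... | no  m∉ = vanish u m m∉

  -- Take `σ` agreeing with an increasing `f` on the leading index and on the support of `u`. A
  -- coefficient of `σ · u` at `m` comes from the preimage of `m` under `σ`: outside the support it
  -- is zero, and inside it `σ` acts as `f`, which reflects the order. So `σ` need not be increasing
  -- elsewhere.
  moveLead : ∀ {i i′ j u} → i ⊑ i′ → Leads (i , j) u →
             ∃[ σ ] (coeff (σ · u) (i′ , j) ≡ coeff u (i , j) × VanishesAbove (i′ , j) (σ · u))
  moveLead {i} {i′} {j} {u} i⊑i′ (_ , above) with ⊑⇒increasing i i′ i⊑i′
  ... | f , f-mono , refl with realise f-mono ((i , j) ∷ supp u)
  ...   | σ , agree = σ , cong (coeff u) σ⁻¹fk≡k , above′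
    where
    k = i , j

    σ⁻¹fk≡k : actᴵ⁻¹ σ (mapᴵ f k) ≡ k
    σ⁻¹fk≡k = trans (cong (actᴵ⁻¹ σ) (sym (agree (here refl)))) (actᴵ⁻¹-actᴵ σ k)

    above′ : VanishesAbove (mapᴵ f k) (σ · u)
    above′ {m} fk<m with actᴵ⁻¹ σ m ∈? supp u
    ... | no  m′∉ = vanish u _ m′∉
    ... | yes m′∈ = above (mapᴵ-cancel-< f-mono
      (subst (mapᴵ f k <ᴵ_) (trans (sym (actᴵ-actᴵ⁻¹ σ m)) (agree (there m′∈))) fk<m))

-- Decreasing absolute values of integers

∣m⊖1+n∣<m : ∀ {m n} → suc n ≤ m → ∣ m ℤ.⊖ suc n ∣ < m
∣m⊖1+n∣<m {suc m} {n} n<m = subst (_< suc m)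
  (sym (trans (ℤ.∣m⊖n∣≡∣n⊖m∣ (suc m) (suc n)) (ℤ.∣⊖∣-≤ n<m))) (s≤s (ℕ.m∸n≤m m n))

-- Add for opposite signs and subtract for equal ones: this moves `b` towards zero by the absolute
-- value of `a` without passing it.
subtractSmaller : ∀ a b → a ≢ 0ℤ → ∣ a ∣ ≤ ∣ b ∣ → ∣ b ℤ.+ a ∣ < ∣ b ∣ ⊎ ∣ b ℤ.+ ℤ.- a ∣ < ∣ b ∣
subtractSmaller (ℤ.+ zero)  b          a≢0 _   = contradiction refl a≢0
subtractSmaller (ℤ.+ suc m) (ℤ.+ n)      _   m<n = inj₂ (∣m⊖1+n∣<m m<n)
subtractSmaller (ℤ.+ suc m) -[1+ n ]   _   m<n =
  inj₁ (subst (_< suc n) (ℤ.∣m⊖n∣≡∣n⊖m∣ (suc n) (suc m)) (∣m⊖1+n∣<m m<n))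
subtractSmaller -[1+ m ]  (ℤ.+ n)      _   m<n = inj₁ (∣m⊖1+n∣<m m<n)
subtractSmaller -[1+ m ]  -[1+ n ]   _   m<n =
  inj₂ (subst (_< suc n) (ℤ.∣m⊖n∣≡∣n⊖m∣ (suc n) (suc m)) (∣m⊖1+n∣<m m<n))

-- Spans of orbits

lowerEM : ∀ {ℓ} → ExcludedMiddle ℓ → ExcludedMiddle 0ℓ
lowerEM {ℓ} em {P} = Dec.map′ lower lift (em {Lift ℓ P})

module _ {ℓ : Level} {c d : ℕ} (L : Pred (FinSupp c d) ℓ) (lattice : IsLattice L) (invariant : SymInvariant L) where

  private module L = IsSubgroup lattice

  Span : List (FinSupp c d) → Pred (FinSupp c d) 0ℓ
  Span B = Generated ℤ^⟨ c , d ⟩ (SymOrbit B)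

  Span⊆L : ∀ {B} → All L B → ∀ {u} → Span B u → L u
  Span⊆L B⊆L (gen (σ , u , u∈B , v≈σu)) = L.resp (λ k → sym (v≈σu k)) (invariant σ (All.lookup B⊆L u∈B))
  Span⊆L B⊆L (resp u≈v s) = L.resp u≈v (Span⊆L B⊆L s)
  Span⊆L B⊆L unit         = L.ε-closed
  Span⊆L B⊆L (mult s t)   = L.∙-closed (Span⊆L B⊆L s) (Span⊆L B⊆L t)
  Span⊆L B⊆L (inv s)      = L.⁻¹-closed (Span⊆L B⊆L s)

  orbit⊆Span : ∀ {B u} σ → u ∈ B → Span B (σ · u)
  orbit⊆Span {u = u} σ u∈B = gen (σ , u , u∈B , λ _ → refl)

  Span-cancelʳ : ∀ {B} v {t} → Span B t → Span B (v ⊕ t) → Span B v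
  Span-cancelʳ v {t} t∈ v+t∈ = resp eq (mult v+t∈ (inv t∈))
    where
    eq : (v ⊕ t) ⊕ ⊖ t ≈ v
    eq k = trans (ℤ.+-assoc (coeff v k) (coeff t k) _)
      (trans (cong (ℤ._+_ (coeff v k)) (ℤ.+-inverseʳ (coeff t k))) (ℤ.+-identityʳ (coeff v k)))

  MissedBy : List (FinSupp c d) → Pred (Index c d × ℕ) ℓ
  MissedBy B (k , a) = ∃[ u ] (L u × ¬ Span B u × Leads k u × ∣ coeff u k ∣ ≡ a)

  MinimalMissedBy : List (FinSupp c d) → Pred (Index c d × ℕ) ℓ
  MinimalMissedBy B x = MissedBy B x × ∀ y → y ≺ x → ¬ MissedBy B y

  -- Adding `t` keeps `v` in `L` and outside the span, and creates nothing above `k`. If the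
  -- coefficient at `k` shrank, `v ⊕ t` would have smaller leading data than the minimal `v`.
  minimal-irreducible : ∀ {B k a} (((v , _) , _) : MinimalMissedBy B (k , a)) {t} →
    L t → Span B t → VanishesAbove k t → ¬ ∣ coeff v k ℤ.+ coeff t k ∣ < ∣ coeff v k ∣
  minimal-irreducible {B} {k} ((v , Lv , v∉ , (_ , v-above) , refl) , minimal) {t} Lt t∈ t-above smaller
    with zeroOrLeads (v ⊕ t)
  -- Zero lies in every span, so here `v` would lie in the span too.
  ... | inj₁ v+t≈𝟎 = v∉ (Span-cancelʳ v t∈ (resp (λ m → sym (v+t≈𝟎 m)) unit))
  ... | inj₂ (m , leads) with compareᴵ m k
  ...   | inj₁ m<k         = minimal _ (inj₁ m<k)
    (v ⊕ t , L.∙-closed Lv Lt , v∉ ∘ Span-cancelʳ v t∈ , leads , refl)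
  ...   | inj₂ (inj₁ refl) = minimal _ (inj₂ (refl , smaller))
    (v ⊕ t , L.∙-closed Lv Lt , v∉ ∘ Span-cancelʳ v t∈ , leads , refl)
  ...   | inj₂ (inj₂ k<m)  = proj₁ leads (cong₂ ℤ._+_ (v-above k<m) (t-above k<m))

  -- Otherwise a translate of `u`, or its negative, has its leading term at the leading index of the
  -- minimal `v` and reduces the coefficient there, against `minimal-irreducible`.
  minimal-⋠ : ∀ {B k a y u} → u ∈ B → L u → Leads k u → ∣ coeff u k ∣ ≡ a →
              MinimalMissedBy B y → ¬ (k , a) ≼ y
  minimal-⋠ {k = i , j} {y = (i′ , .j) , _} {u} u∈B Lu leads refl min@((v , _ , _ , _ , refl) , _) (i⊑i′ , refl , a≤a′)
    with moveLead {u = u} i⊑i′ leads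
  ... | σ , same , above
    with subtractSmaller (coeff u (i , j)) (coeff v (i′ , j)) (proj₁ leads) a≤a′
  ...   | inj₁ smaller = minimal-irreducible min (invariant σ Lu) (orbit⊆Span σ u∈B) above
    (subst (λ z → ∣ coeff v (i′ , j) ℤ.+ z ∣ < _) (sym same) smaller)
  ...   | inj₂ smaller = minimal-irreducible min (L.⁻¹-closed (invariant σ Lu)) (inv (orbit⊆Span σ u∈B)) (cong ℤ.-_ ∘ above)
    (subst (λ z → ∣ coeff v (i′ , j) ℤ.+ ℤ.- z ∣ < _) (sym same) smaller)

  -- The infinite chain of minimal missed elements

  module _ (em : ExcludedMiddle ℓ) (notFG : ¬ HasFiniteEquivariantGeneratingSet L) where

    missed : ∀ {B} → All L B → ∃ (MissedBy B)
    missed {B} B⊆L with em {∃[ u ] (L u × ¬ Span B u)}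
    ... | no  none = ⊥-elim (notFG (B , B⊆L , (λ {u} → L⊆Span {u}) , (λ {u} → Span⊆L B⊆L {u})))
      where
      L⊆Span : ∀ {u} → L u → Span B u
      L⊆Span {u} Lu = decidable-stable (lowerEM em) λ u∉ → none (u , Lu , u∉)
    ... | yes (u , Lu , u∉) with zeroOrLeads u
    -- A missed element is nonzero, hence has a leading term.
    ...   | inj₁ u≈𝟎         = contradiction (resp (λ k → sym (u≈𝟎 k)) unit) u∉
    ...   | inj₂ (k , leads) = (k , _) , u , Lu , u∉ , leads , refl

    -- Excluded middle decides the proof-relevant Σ-type, so it also acts as the
    -- choice function behind chain.
    abstract
      minimalMissed : ∀ {B} → All L B → ∃ (MinimalMissedBy B)
      minimalMissed {B} B⊆L = least ≺-wellFounded (MissedBy B) (λ _ → em) (missed B⊆L)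

    -- The list carries its proof of membership in `L` because the choice of the next element
    -- depends on it.
    chain : ℕ → ∃ (All L)
    chain zero    = [] , []
    chain (suc n) =
      let B , B⊆L                = chain n
          _ , (u , Lu , _) , _   = minimalMissed B⊆L
      in  u ∷ B , Lu ∷ B⊆L

    selected : ∀ n → ∃ (MinimalMissedBy (proj₁ (chain n)))
    selected n = minimalMissed (proj₂ (chain n))

    element : ℕ → FinSupp c d
    element n = proj₁ (proj₁ (proj₂ (selected n)))

    element∈chain : ∀ {m n} → m < n → element m ∈ proj₁ (chain n)
    element∈chain {m} {suc n} m<1+n with ℕ.m<1+n⇒m<n∨m≡n m<1+n
    ... | inj₁ m<n  = there (element∈chain m<n)
    -- The head of `chain (suc n)` is `element n` by definition.
    ... | inj₂ refl = here refl

    notFG-absurd : ⊥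
    notFG-absurd with ≼-good (lowerEM em) (proj₁ ∘ selected)
    ... | m , n , m<n , m≼n =
      let (_ , Lu , _ , leads , eq) , _ = proj₂ (selected m)
      in  minimal-⋠ (element∈chain m<n) Lu leads eq (proj₂ (selected n)) m≼n

theorem5p1 : {ℓ : Level} → ExcludedMiddle ℓ →
    (c d : ℕ) → .{{_ : NonZero c}} → .{{_ : NonZero d}} →
    (L : Pred (FinSupp c d) ℓ) → IsLattice L → SymInvariant L →
    HasFiniteEquivariantGeneratingSet L
theorem5p1 em c d L lattice invariant = decidable-stable em (notFG-absurd L lattice invariant em)
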